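{- Suppose $\mathbb K$ is a computable age with the joint embedding property (JEP). Then $\mathbb K$ also has the $\mathscr{EI}(\mathbb K)$-computable joint embedding property; that is, there is a function $f$ with domain $\mathbb K\times\mathbb K$, computable from the embedding information $\mathscr{EI}(\mathbb K)$, such that for all $\mathbb I(\ell_0),\mathbb I(\ell_1)\in\mathbb K$ we have $f(\mathbb I(\ell_0),\mathbb I(\ell_1))=(F_0,F_1)$ where $F_0$ and $F_1$ are embeddings in $\mathbb K$, $\mathrm{dom}(F_0)=\mathbb I(\ell_0)$, $\mathrm{dom}(F_1)=\mathbb I(\ell_1)$, and $\mathrm{codom}(F_0)=\mathrm{codom}(F_1)$.
   Context: Languages and structures. $\mathcal{L}$ is a countable language (relation symbols of positive arity; function symbols of any arity, 0-ary ones being constants) with a computable representation: relation symbols $R_n$ and function symbols $F_m$ are indexed bijectively by disjoint computable subsets of $\omega$, with arity computable from the index. An $\mathcal{L}$-structure $\mathcal{M}$ is c.e. if its underlying set $M$ is a c.e. subset of $\omega$ and the sets $\{(n,\mathbf a): \mathcal M\models R_n(\mathbf a)\}$, $\{(n,\mathbf a): \mathcal M\models \neg R_n(\mathbf a)\}$, $\{(m,\mathbf a,b): \mathcal M\models F_m(\mathbf a)=b\}$ are c.e.; it is computable if moreover $M$ is computable. Tuples are finite; $\mathrm{cl}_{\mathcal M}(\mathbf a)$ is the smallest substructure of $\mathcal M$ containing $\mathbf a$. For $\mathbf a\in\mathcal A$, $\mathbf b\in\mathcal B$ of the same length, $\mathbf a\simeq\mathbf b$ means that for every atomic $\mathcal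 L$-formula $\varphi$, $\mathcal A\models\varphi(\mathbf a)$ iff $\mathcal B\models\varphi(\mathbf b)$; equivalently $\mathbf a\mapsto\mathbf b$ extends to an isomorphism $\mathrm{cl}(\mathbf a)\to\mathrm{cl}(\mathbf b)$. Ages. An age is a collection of finitely generated $\mathcal L$-structures closed under isomorphism. A computable age (computable representation of an age $\mathcal K$) is a c.e. set $\mathbb K$ of triples $(\mathbf a,\mathcal A,i)$ (computable structures being given by indices), with exactly one triple for each $i\in\omega$, written $\mathbb I(i)=(\mathbf a_i,\mathcal A_i,i)$, such that each $\mathcal A_i$ is a computable $\mathcal L$-structure in $\mathcal K$ with $\mathcal A_i=\mathrm{cl}_{\mathcal A_i}(\mathbf a_i)$, and every $\mathcal B\in\mathcal K$ is isomorphic to some $\mathcal A_i$. $\mathbb K$ is said to have a property of ages if $\mathcal K$ does. The embedding information $\mathscr{EI}(\mathbb K)$ is the set of tuples $(\mathbb I(k_0),\mathbf b_0,\mathbb I(k_1),\mathbf b_1)$ with $\mathbf b_0\in\mathcal A_{k_0}$, $\mathbf b_1\in\mathcal A_{k_1}$ and $\mathbf b_0\simeq\mathbf b_1$. A potential embedding in $\mathbb K$ is a triple $F=(\mathbb I(i),\mathbb I(j),\mathbf c)$ with $\mathbf c\in\mathcal A_j$ a tuple; $\mathrm{dom}(F)=\mathbb I(i)$, $\mathrm{codom}(F)=\mathbb I(j)$; it is an embedding if $\mathbf a_i\simeq\mathbf c$. (JEP): for all $\mathcal A,\mathcal B\in\mathcal K$ there is $\mathcal C\in\mathcal K$ for which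 there are embeddings $\mathcal A\to\mathcal C$ and $\mathcal B\to\mathcal C$. -}

module Defs where

open import Level using (Level; 0ℓ) renaming (suc to lsuc)
open import Data.Bool using (Bool; T; _∨_; if_then_else_)
open import Data.Fin using (Fin)
open import Data.Nat using (ℕ; zero; suc; _+_; _<_)
open import Data.Nat.Properties using (+-suc; +-identityʳ)
open import Data.Product using (Σ; Σ-syntax; ∃; ∃-syntax; _×_; _,_; proj₁; proj₂)
open import Data.Sum using (_⊎_)
open import Data.Vec using (Vec; []; _∷_; map; lookup; cast)
open import Data.Vec.Relation.Unary.All using (All)
open import Function.Bundles using (_⇔_)
open import Function.Definitions using (Injective; StrictlySurjective)
open import Relation.Binary.PropositionalEquality
open import Relation.Nullary using (¬_)
open import Relation.Unary using (Pred; ∅)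

------------------------------------------------------------------------
-- Coding of pairs and tuples

-- Cantor's bijection ℕ × ℕ → ℕ.  The pairs are listed diagonal by
-- diagonal; `next` is the successor operation of that listing.

triangle : ℕ → ℕ
triangle zero    = 0
triangle (suc n) = suc n + triangle n

⟨_,_⟩ : ℕ → ℕ → ℕ
⟨ x , y ⟩ = y + triangle (x + y)

next : ℕ × ℕ → ℕ × ℕ
next (zero  , y) = suc y , 0
next (suc x , y) = x , suc y

unpair : ℕ → ℕ × ℕ
unpair zero    = 0 , 0
unpair (suc n) = next (unpair n)

π₁ π₂ : ℕ → ℕ
π₁ n = proj₁ (unpair n)
π₂ n = proj₂ (unpair n)

mutual
  unpair-triangle : ∀ d → unpair (triangle d) ≡ (d , 0)
  unpair-triangle zero    = refl
  unpair-triangle (suc d) = cong next (unpair-diagonal d 0 d refl)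

  unpair-diagonal : ∀ d x y → x + y ≡ d → unpair (y + triangle d) ≡ (x , y)
  unpair-diagonal d x zero    eq =
    trans (unpair-triangle d) (cong (_, 0) (trans (sym eq) (+-identityʳ x)))
  unpair-diagonal d x (suc y) eq =
    cong next (unpair-diagonal d (suc x) y (trans (sym (+-suc x y)) eq))

unpair-⟨,⟩ : ∀ x y → unpair ⟨ x , y ⟩ ≡ (x , y)
unpair-⟨,⟩ x y = unpair-diagonal (x + y) x y refl

⟨,⟩-next : ∀ p → ⟨ proj₁ (next p) , proj₂ (next p) ⟩ ≡ suc ⟨ proj₁ p , proj₂ p ⟩
⟨,⟩-next (zero  , y) rewrite +-identityʳ y = refl
⟨,⟩-next (suc x , y) rewrite +-suc x y     = refl

⟨π₁,π₂⟩ : ∀ n → ⟨ π₁ n , π₂ n ⟩ ≡ n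
⟨π₁,π₂⟩ zero    = refl
⟨π₁,π₂⟩ (suc n) = trans (⟨,⟩-next (unpair n)) (cong suc (⟨π₁,π₂⟩ n))

⟨,⟩-injective : ∀ a b c d → ⟨ a , b ⟩ ≡ ⟨ c , d ⟩ → a ≡ c × b ≡ d
⟨,⟩-injective a b c d eq = cong proj₁ same , cong proj₂ same
  where
  same : (a , b) ≡ (c , d)
  same = trans (sym (unpair-⟨,⟩ a b)) (trans (cong unpair eq) (unpair-⟨,⟩ c d))

-- Injective on the union over all n, so a code determines the length.
tupleCode : ∀ {n} → Vec ℕ n → ℕ
tupleCode []       = 0
tupleCode (x ∷ xs) = suc ⟨ x , tupleCode xs ⟩

------------------------------------------------------------------------
-- Oracle computability

-- Programs for the partial functions ℕ ⇀ ℕ that are recursive in an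
-- oracle.  Several arguments are passed as one coded pair.

data Code : Set where
  zero succ left right oracle : Code
  pair comp prec              : Code → Code → Code
  rfind                       : Code → Code

Prec : (F G : ℕ → ℕ → Set) → ℕ → ℕ → ℕ → Set
Prec F G a zero    m = F a m
Prec F G a (suc k) m = ∃[ r ] Prec F G a k r × G ⟨ a , ⟨ k , r ⟩ ⟩ m

-- ⟦ e ⟧ X n m : the program e, run on input n with an oracle for the
-- set X, halts with output m.  The output of `rfind f` on a is the least
-- k with f ⟨ a , k ⟩ = 0, where f must be defined at all smaller values.
-- Having an answer to every oracle query is excluded middle for X.

⟦_⟧ : Code → Pred ℕ 0ℓ → ℕ → ℕ → Set
⟦ zero ⟧     X n m = m ≡ 0
⟦ succ ⟧     X n m = m ≡ suc n
⟦ left ⟧     X n m = m ≡ π₁ n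
⟦ right ⟧    X n m = m ≡ π₂ n
⟦ oracle ⟧   X n m = (X n × m ≡ 1) ⊎ (¬ X n × m ≡ 0)
⟦ pair f g ⟧ X n m = ∃[ a ] ∃[ b ] ⟦ f ⟧ X n a × ⟦ g ⟧ X n b × m ≡ ⟨ a , b ⟩
⟦ comp f g ⟧ X n m = ∃[ k ] ⟦ g ⟧ X n k × ⟦ f ⟧ X k m
⟦ prec f g ⟧ X n m = Prec (⟦ f ⟧ X) (⟦ g ⟧ X) (π₁ n) (π₂ n) m
⟦ rfind f ⟧  X n m =
  ⟦ f ⟧ X ⟨ n , m ⟩ 0 × (∀ k → k < m → ∃[ v ] ⟦ f ⟧ X ⟨ n , k ⟩ (suc v))

number : Code → ℕ
number zero       = ⟨ 0 , 0 ⟩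
number succ       = ⟨ 1 , 0 ⟩
number left       = ⟨ 2 , 0 ⟩
number right      = ⟨ 3 , 0 ⟩
number oracle     = ⟨ 4 , 0 ⟩
number (pair f g) = ⟨ 5 , ⟨ number f , number g ⟩ ⟩
number (comp f g) = ⟨ 6 , ⟨ number f , number g ⟩ ⟩
number (prec f g) = ⟨ 7 , ⟨ number f , number g ⟩ ⟩
number (rfind f)  = ⟨ 8 , number f ⟩

number-injective : ∀ {c d} → number c ≡ number d → c ≡ d
number-injective {c} {d} eq = go c d
  (trans (sym (tag-number c)) (trans (cong π₁ eq) (tag-number d))) eq
  where
  tag : Code → ℕ
  tag zero       = 0
  tag succ       = 1
  tag left       = 2
  tag right      = 3
  tag oracle     = 4
  tag (pair _ _) = 5
  tag (comp _ _) = 6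
  tag (prec _ _) = 7
  tag (rfind _)  = 8

  tag-number : ∀ e → π₁ (number e) ≡ tag e
  tag-number zero       = refl
  tag-number succ       = refl
  tag-number left       = refl
  tag-number right      = refl
  tag-number oracle     = refl
  tag-number (pair f g) = cong proj₁ (unpair-⟨,⟩ 5 ⟨ number f , number g ⟩)
  tag-number (comp f g) = cong proj₁ (unpair-⟨,⟩ 6 ⟨ number f , number g ⟩)
  tag-number (prec f g) = cong proj₁ (unpair-⟨,⟩ 7 ⟨ number f , number g ⟩)
  tag-number (rfind f)  = cong proj₁ (unpair-⟨,⟩ 8 (number f))

  components : ∀ k f g f′ g′ →
    ⟨ k , ⟨ number f , number g ⟩ ⟩ ≡ ⟨ k , ⟨ number f′ , number g′ ⟩ ⟩ →
    number f ≡ number f′ × number g ≡ number g′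
  components k f g f′ g′ eq =
    ⟨,⟩-injective (number f) (number g) (number f′) (number g′)
      (proj₂ (⟨,⟩-injective k ⟨ number f , number g ⟩ k ⟨ number f′ , number g′ ⟩ eq))

  go : ∀ c d → tag c ≡ tag d → number c ≡ number d → c ≡ d
  go zero       zero         refl _  = refl
  go succ       succ         refl _  = refl
  go left       left         refl _  = refl
  go right      right        refl _  = refl
  go oracle     oracle       refl _  = refl
  go (pair f g) (pair f′ g′) refl eq =
    let p , q = components 5 f g f′ g′ eq in
    cong₂ pair (number-injective p) (number-injective q)
  go (comp f g) (comp f′ g′) refl eq =
    let p , q = components 6 f g f′ g′ eq in
    cong₂ comp (number-injective p) (number-injective q)
  go (prec f g) (prec f′ g′) refl eq =
    let p , q = components 7 f g f′ g′ eq in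
    cong₂ prec (number-injective p) (number-injective q)
  go (rfind f)  (rfind f′)   refl eq =
    cong rfind (number-injective (proj₂ (⟨,⟩-injective 8 (number f) 8 (number f′) eq)))

-- A partial function is given by its graph G; the program must halt
-- exactly on the domain of G.  Without oracle means with oracle ∅.

Computes : Pred ℕ 0ℓ → Code → (ℕ → ℕ → Set) → Set
Computes X e G = ∀ n m → ⟦ e ⟧ X n m ⇔ G n m

ComputableFrom : Pred ℕ 0ℓ → (ℕ → ℕ → Set) → Set
ComputableFrom X G = ∃[ e ] Computes X e G

Decides : Code → (ℕ → Bool) → Set
Decides e χ = Computes ∅ e (λ n m → m ≡ (if χ n then 1 else 0))

Enumerates : Code → Pred ℕ 0ℓ → Set
Enumerates e P = ∀ n → P n ⇔ ∃ (⟦ e ⟧ ∅ n)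

CE : Pred ℕ 0ℓ → Set
CE P = ∃[ e ] Enumerates e P

------------------------------------------------------------------------
-- Languages and structures

-- isRel and isFun are the characteristic functions of the index sets of
-- the relation and function symbols; the values of arity outside these
-- sets are irrelevant.

record Language : Set where
  field
    isRel isFun      : ℕ → Bool
    arity            : ℕ → ℕ
    disjoint         : ∀ n → ¬ (T (isRel n) × T (isFun n))
    rel-positive     : ∀ n → T (isRel n) → 0 < arity n
    isRel-computable : ∃[ e ] Decides e isRel
    isFun-computable : ∃[ e ] Decides e isFun
    arity-computable : ComputableFrom ∅
      (λ n m → T (isRel n ∨ isFun n) × m ≡ arity n)

  RelSym FunSym : Set
  RelSym = Σ[ n ∈ ℕ ] T (isRel n)
  FunSym = Σ[ n ∈ ℕ ] T (isFun n)

  relArity : RelSym → ℕ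
  relArity (n , _) = arity n

  funArity : FunSym → ℕ
  funArity (n , _) = arity n

module _ (L : Language) where
  open Language L

  record Structure : Set₁ where
    field
      Carrier : Set
      rel     : (R : RelSym) → Vec Carrier (relArity R) → Set
      fun     : (F : FunSym) → Vec Carrier (funArity F) → Carrier

  data Term (k : ℕ) : Set where
    var : Fin k → Term k
    app : (F : FunSym) → Vec (Term k) (funArity F) → Term k

  data Atomic (k : ℕ) : Set where
    equal : Term k → Term k → Atomic k
    holds : (R : RelSym) → Vec (Term k) (relArity R) → Atomic k

module _ {L : Language} where
  open Language L
  open Structure

  mutual
    eval : (A : Structure L) → ∀ {k} → Vec (Carrier A) k → Term L k → Carrier A
    eval A a (var i)    = lookup a i
    eval A a (app F ts) = fun A F (evals A a ts)

    evals : (A : Structure L) → ∀ {k n} → Vec (Carrier A) k →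
            Vec (Term L k) n → Vec (Carrier A) n
    evals A a []       = []
    evals A a (t ∷ ts) = eval A a t ∷ evals A a ts

  _⊨_[_] : (A : Structure L) → ∀ {k} → Atomic L k → Vec (Carrier A) k → Set
  A ⊨ equal s t  [ a ] = eval A a s ≡ eval A a t
  A ⊨ holds R ts [ a ] = rel A R (evals A a ts)

  [_,_]_≃_ : (A B : Structure L) → ∀ {k} → Vec (Carrier A) k → Vec (Carrier B) k → Set
  [ A , B ] a ≃ b = ∀ φ → (A ⊨ φ [ a ]) ⇔ (B ⊨ φ [ b ])

  -- The underlying set of the smallest substructure containing a.
  data Cl (A : Structure L) {k} (a : Vec (Carrier A) k) : Carrier A → Set where
    gen : ∀ i → Cl A a (lookup a i)
    app : ∀ F {xs} → All (Cl A a) xs → Cl A a (fun A F xs)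

  GeneratedBy : (A : Structure L) → ∀ {k} → Vec (Carrier A) k → Set
  GeneratedBy A a = ∀ x → Cl A a x

  FinitelyGenerated : Structure L → Set
  FinitelyGenerated A = ∃[ k ] Σ[ a ∈ Vec (Carrier A) k ] GeneratedBy A a

  record _↪_ (A B : Structure L) : Set where
    field
      to        : Carrier A → Carrier B
      injective : Injective _≡_ _≡_ to
      to-rel    : ∀ R xs → rel A R xs ⇔ rel B R (map to xs)
      to-fun    : ∀ F xs → to (fun A F xs) ≡ fun B F (map to xs)

  record _≅_ (A B : Structure L) : Set where
    field
      embedding  : A ↪ B
      surjective : StrictlySurjective _≡_ (_↪_.to embedding)

record ComputableStructure (L : Language) : Set₁ where
  open Language L
  field
    dom : ℕ → Bool

  Elem : Set
  Elem = Σ[ n ∈ ℕ ] T (dom n)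

  code : ∀ {n} → Vec Elem n → ℕ
  code a = tupleCode (map proj₁ a)

  field
    rel : (R : RelSym) → Vec Elem (relArity R) → Set
    fun : (F : FunSym) → Vec Elem (funArity F) → Elem

    dom-code rel-code nrel-code fun-code : Code

    dom-computable : Decides dom-code dom
    rel-ce  : Enumerates rel-code
      (λ x → ∃[ R ] ∃[ a ] x ≡ ⟨ proj₁ R , code a ⟩ × rel R a)
    nrel-ce : Enumerates nrel-code
      (λ x → ∃[ R ] ∃[ a ] x ≡ ⟨ proj₁ R , code a ⟩ × ¬ rel R a)
    fun-ce  : Enumerates fun-code
      (λ x → ∃[ F ] ∃[ a ] ∃[ b ]
        x ≡ ⟨ proj₁ F , ⟨ code a , proj₁ b ⟩ ⟩ × fun F a ≡ b)

  structure : Structure L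
  structure = record { Carrier = Elem ; rel = rel ; fun = fun }

  index : ℕ
  index = ⟨ number dom-code , ⟨ number rel-code , ⟨ number nrel-code , number fun-code ⟩ ⟩ ⟩

------------------------------------------------------------------------
-- Ages

record Age (L : Language) (ℓ : Level) : Set (lsuc 0ℓ Level.⊔ lsuc ℓ) where
  field
    Member     : Pred (Structure L) ℓ
    fin-gen    : ∀ {A} → Member A → FinitelyGenerated A
    iso-closed : ∀ {A B} → A ≅ B → Member A → Member B

JEP : ∀ {L ℓ} → Age L ℓ → Set (lsuc 0ℓ Level.⊔ ℓ)
JEP {L} K = ∀ {A B} → Member A → Member B →
            Σ[ C ∈ Structure L ] Member C × (A ↪ C) × (B ↪ C)
  where open Age K

-- The c.e. set of triples is presented through its listing 𝕀; having
-- exactly one triple for each third component i is built into this form.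

record ComputableAge {L : Language} {ℓ} (K : Age L ℓ) : Set (lsuc 0ℓ Level.⊔ ℓ) where
  open Age K
  open ComputableStructure using (Elem; structure; code; index)
  field
    𝒜         : ℕ → ComputableStructure L
    len       : ℕ → ℕ
    gens      : ∀ i → Vec (Elem (𝒜 i)) (len i)
    member    : ∀ i → Member (structure (𝒜 i))
    generated : ∀ i → GeneratedBy (structure (𝒜 i)) (gens i)
    complete  : ∀ {B} → Member B → ∃[ i ] B ≅ structure (𝒜 i)

  𝕀 : ℕ → ℕ
  𝕀 i = ⟨ code (𝒜 i) (gens i) , ⟨ index (𝒜 i) , i ⟩ ⟩

  field
    triples-ce : CE (λ x → ∃[ i ] x ≡ 𝕀 i)

  -- The embedding information.
  EI : Pred ℕ 0ℓ
  EI x = ∃[ k₀ ] ∃[ k₁ ] ∃[ n ]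
    Σ[ b₀ ∈ Vec (Elem (𝒜 k₀)) n ] Σ[ b₁ ∈ Vec (Elem (𝒜 k₁)) n ]
      x ≡ ⟨ 𝕀 k₀ , ⟨ code (𝒜 k₀) b₀ , ⟨ 𝕀 k₁ , code (𝒜 k₁) b₁ ⟩ ⟩ ⟩
      × [ structure (𝒜 k₀) , structure (𝒜 k₁) ] b₀ ≃ b₁

  record PotentialEmbedding : Set where
    field
      source target : ℕ
      {width}       : ℕ
      tuple         : Vec (Elem (𝒜 target)) width

    domain codomain : ℕ
    domain   = 𝕀 source
    codomain = 𝕀 target

    embeddingCode : ℕ
    embeddingCode = ⟨ domain , ⟨ codomain , code (𝒜 target) tuple ⟩ ⟩

    IsEmbedding : Set
    IsEmbedding = Σ[ eq ∈ len source ≡ width ]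
      [ structure (𝒜 source) , structure (𝒜 target) ] cast eq (gens source) ≃ tuple

  open PotentialEmbedding

  -- The X-computable joint embedding property.  As 𝕀 is injective, a
  -- function on the set of pairs of triples is a function of the indices.
  ComputableJEP : Pred ℕ 0ℓ → Set
  ComputableJEP X = Σ[ f ∈ (ℕ → ℕ → PotentialEmbedding × PotentialEmbedding) ]
    ComputableFrom X (λ x y → ∃[ ℓ₀ ] ∃[ ℓ₁ ]
      x ≡ ⟨ 𝕀 ℓ₀ , 𝕀 ℓ₁ ⟩ ×
      y ≡ ⟨ embeddingCode (proj₁ (f ℓ₀ ℓ₁)) , embeddingCode (proj₂ (f ℓ₀ ℓ₁)) ⟩)
    × (∀ ℓ₀ ℓ₁ → let (F₀ , F₁) = f ℓ₀ ℓ₁ in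
        IsEmbedding F₀ × IsEmbedding F₁
        × domain F₀ ≡ 𝕀 ℓ₀ × domain F₁ ≡ 𝕀 ℓ₁
        × codomain F₀ ≡ codomain F₁)

{-# OPTIONS --safe #-}

-- An element of the age is named by a code 𝕀 i whose first component is the
-- code of its generators.  Hence, for a number u, the query
-- ⟨ u , ⟨ π₁ u , ⟨ t , c ⟩ ⟩ ⟩ ∈ EI expresses at once that u and t name members
-- of the age and that c codes a tuple giving an embedding of the first into the
-- second.  Given u and v, an oracle program searches for the least
-- ⟨ t , ⟨ c , d ⟩ ⟩ with both queries positive.  The search halts if u and v
-- name members, by the joint embedding property, and only then.

module Submission where

open import Defs
open import Level using (0ℓ)
open import Axiom.ExcludedMiddle using (ExcludedMiddle)
open import Data.Bool.Properties using (T-irrelevant)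
open import Data.Empty using (⊥-elim)
open import Data.Nat using (ℕ; zero; suc; _<_)
open import Data.Nat.Induction using (<-rec)
open import Data.Nat.Properties using (<-cmp; suc-injective)
open import Data.Product using (Σ-syntax; ∃; ∃-syntax; _×_; _,_; proj₁; proj₂)
open import Data.Sum using (inj₁; inj₂)
open import Data.Vec using (Vec; []; _∷_; map; cast)
open import Data.Vec.Properties using (lookup-map)
open import Function.Base using (_∘_)
open import Function.Bundles using (_⇔_; mk⇔; module Equivalence)
open import Function.Properties.Equivalence using () renaming (trans to ⇔-trans)
open import Relation.Binary.Definitions using (tri<; tri≈; tri>)
open import Relation.Binary.PropositionalEquality
open import Relation.Nullary using (¬_; yes; no)
open import Relation.Unary using (Pred)

open Equivalence using (to; from)

-- Projections of pairs and least witnesses.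

π₁-⟨,⟩ : ∀ x y → π₁ ⟨ x , y ⟩ ≡ x
π₁-⟨,⟩ x y = cong proj₁ (unpair-⟨,⟩ x y)

π₂-⟨,⟩ : ∀ x y → π₂ ⟨ x , y ⟩ ≡ y
π₂-⟨,⟩ x y = cong proj₂ (unpair-⟨,⟩ x y)

Least : Pred ℕ 0ℓ → Pred ℕ 0ℓ
Least P m = P m × (∀ k → k < m → ¬ P k)

Least-unique : ∀ {P m n} → Least P m → Least P n → m ≡ n
Least-unique {m = m} {n} (pm , m-least) (pn , n-least) with <-cmp m n
... | tri< m<n _ _ = ⊥-elim (n-least m m<n pm)
... | tri≈ _ eq _  = eq
... | tri> _ _ n<m = ⊥-elim (m-least n n<m pn)

-- Strong induction on the given witness. As `P` is arbitrary, excluded middle tells at each stage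
-- whether a smaller witness exists.
least : ExcludedMiddle 0ℓ → ∀ {P : Pred ℕ 0ℓ} → ∃ P → ∃ (Least P)
least em {P} (n , pn) = <-rec (λ n → P n → ∃ (Least P)) step n pn
  where
  step : ∀ n → (∀ {k} → k < n → P k → ∃ (Least P)) → P n → ∃ (Least P)
  step n rec pn with em {∃[ k ] k < n × P k}
  ... | yes (k , k<n , pk) = rec k<n pk
  ... | no none            = n , pn , λ k k<n pk → none (k , k<n , pk)

-- Programs relative to an oracle.

-- Turns the oracle's answers 1 and 0 into 0 and 1, as π₁ 2 = 0 and π₁ 1 = 1.
query : Code → Code
query e = comp left (comp succ (comp oracle e))

module _ {X : Pred ℕ 0ℓ} where

  record _computes_ (e : Code) (f : ℕ → ℕ) : Set where
    constructor computes-by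
    field behaviour : Computes X e (λ n m → m ≡ f n)

    value : ∀ n {m} → ⟦ e ⟧ X n m → m ≡ f n
    value n {m} = to (behaviour n m)

    run : ∀ n → ⟦ e ⟧ X n (f n)
    run n = from (behaviour n _) refl

    run-≡ : ∀ n {m} → m ≡ f n → ⟦ e ⟧ X n m
    run-≡ n {m} = from (behaviour n m)
  open _computes_

  left-computes : left computes π₁
  left-computes = computes-by λ n m → mk⇔ (λ r → r) (λ r → r)

  right-computes : right computes π₂
  right-computes = computes-by λ n m → mk⇔ (λ r → r) (λ r → r)

  pair-computes : ∀ {e d f g} → e computes f → d computes g →
                  pair e d computes (λ n → ⟨ f n , g n ⟩)
  pair-computes {f = f} {g} ef dg = computes-by λ n m → mk⇔
    (λ (a , b , ra , rb , eq) → trans eq (cong₂ ⟨_,_⟩ (value ef n ra) (value dg n rb)))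
    (λ eq → f n , g n , run ef n , run dg n , eq)

  comp-computes : ∀ {e d f g} → e computes f → d computes g →
                    comp e d computes (f ∘ g)
  comp-computes {f = f} {g} ef dg = computes-by λ n m → mk⇔
    (λ (k , rk , rm) → trans (value ef k rm) (cong f (value dg n rk)))
    (λ eq → g n , run dg n , run-≡ ef (g n) eq)

  -- Truth is the output 0, since `rfind` searches for zeros. Off `P` any positive output is
  -- allowed, which is what lets `pair` act as conjunction.
  record _tests_ (e : Code) (P : Pred ℕ 0ℓ) : Set where
    field
      total : ∀ n → ∃ (⟦ e ⟧ X n)
      sound : ∀ {n} → ⟦ e ⟧ X n 0 → P n
      exact : ∀ {n m} → ⟦ e ⟧ X n m → P n → m ≡ 0
  open _tests_

  -- Excluded middle enters only in totality: the oracle answers at `f n` only once `X (f n)` or its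
  -- negation is given.
  query-tests : ExcludedMiddle 0ℓ → ∀ {e f} → e computes f →
                query e tests (X ∘ f)
  query-tests em {e} {f} ef = record { total = total′ ; sound = sound′ ; exact = exact′ }
    where
    total′ : ∀ n → ∃ (⟦ query e ⟧ X n)
    total′ n with em {X (f n)}
    ... | yes p = 0 , 2 , (1 , (f n , run ef n , inj₁ (p , refl)) , refl) , refl
    ... | no ¬p = 1 , 1 , (0 , (f n , run ef n , inj₂ (¬p , refl)) , refl) , refl

    sound′ : ∀ {n} → ⟦ query e ⟧ X n 0 → X (f n)
    sound′ {n} (_ , (_ , (k , rk , inj₁ (p , _)) , _) , _) = subst X (value ef n rk) p
    sound′ (_ , (_ , (_ , _ , inj₂ (_ , refl)) , refl) , ())

    exact′ : ∀ {n m} → ⟦ query e ⟧ X n m → X (f n) → m ≡ 0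
    exact′ (_ , (_ , (_ , _ , inj₁ (_ , refl)) , refl) , eq) _ = eq
    exact′ {n} (_ , (_ , (k , rk , inj₂ (¬p , _)) , _) , _) p =
      ⊥-elim (¬p (subst X (sym (value ef n rk)) p))

  -- ⟨ a , b ⟩ = 0 exactly if a = b = 0.
  pair-tests : ∀ {e d P Q} → e tests P → d tests Q →
               pair e d tests (λ n → P n × Q n)
  pair-tests {e} {d} eP dQ = record
    { total = λ n → let a , ra = total eP n ; b , rb = total dQ n in
                    ⟨ a , b ⟩ , a , b , ra , rb , refl
    ; sound = λ { {n} (a , b , ra , rb , eq) →
                  let a≡0 , b≡0 = ⟨,⟩-injective 0 0 a b eq in
                  sound eP (subst (⟦ e ⟧ X n) (sym a≡0) ra) ,
                  sound dQ (subst (⟦ d ⟧ X n) (sym b≡0) rb) }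
    ; exact = λ { (a , b , ra , rb , eq) (p , q) →
                  trans eq (cong₂ ⟨_,_⟩ (exact eP ra p) (exact dQ rb q)) }
    }

  -- Totality of the test turns failure of `R` below the least value into the positive outputs that
  -- `rfind` demands. Where no `k` satisfies `R n`, both sides are empty: the search diverges.
  rfind-tests : ∀ {e} {R : ℕ → Pred ℕ 0ℓ} → e tests (λ z → R (π₁ z) (π₂ z)) →
                Computes X (rfind e) (λ n → Least (R n))
  rfind-tests {e} {R} eR n m = mk⇔
    (λ (r , below) → decode (sound eR r) , λ k k<m → refute (below k k<m))
    (λ (p , below) → halts p , λ k k<m → positive (below k k<m))
    where
    decode : ∀ {k} → R (π₁ ⟨ n , k ⟩) (π₂ ⟨ n , k ⟩) → R n k
    decode {k} = subst₂ R (π₁-⟨,⟩ n k) (π₂-⟨,⟩ n k)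

    encode : ∀ {k} → R n k → R (π₁ ⟨ n , k ⟩) (π₂ ⟨ n , k ⟩)
    encode {k} = subst₂ R (sym (π₁-⟨,⟩ n k)) (sym (π₂-⟨,⟩ n k))

    refute : ∀ {k} → ∃[ v ] ⟦ e ⟧ X ⟨ n , k ⟩ (suc v) → ¬ R n k
    refute (v , r) p with () ← exact eR r (encode p)

    halts : ∀ {k} → R n k → ⟦ e ⟧ X ⟨ n , k ⟩ 0
    halts {k} p with v , r ← total eR ⟨ n , k ⟩ =
      subst (⟦ e ⟧ X ⟨ n , k ⟩) (exact eR r (encode p)) r

    positive : ∀ {k} → ¬ R n k → ∃[ v ] ⟦ e ⟧ X ⟨ n , k ⟩ (suc v)
    positive {k} ¬p with total eR ⟨ n , k ⟩
    ... | zero  , r = ⊥-elim (¬p (decode (sound eR r)))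
    ... | suc v , r = v , r

-- Embeddings and atomic formulas.

module _ {L : Language} where
  open Structure
  open _↪_

  mutual
    eval-↪ : ∀ {A B : Structure L} (h : A ↪ B) {k} (a : Vec (Carrier A) k) t →
             to h (eval A a t) ≡ eval B (map (to h) a) t
    eval-↪ h a (var i)    = sym (lookup-map i (to h) a)
    eval-↪ {A} {B} h a (app F ts) =
      trans (to-fun h F (evals A a ts)) (cong (fun B F) (evals-↪ h a ts))

    evals-↪ : ∀ {A B : Structure L} (h : A ↪ B) {k n} (a : Vec (Carrier A) k)
              (ts : Vec (Term L k) n) →
              map (to h) (evals A a ts) ≡ evals B (map (to h) a) ts
    evals-↪ h a []       = refl
    evals-↪ h a (t ∷ ts) = cong₂ _∷_ (eval-↪ h a t) (evals-↪ h a ts)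

  -- Embeddings commute with evaluation of terms; injectivity then reflects equations, and `to-rel`
  -- handles the relation symbols.
  ↪⇒≃ : ∀ {A B : Structure L} (h : A ↪ B) {k} (a : Vec (Carrier A) k) →
        [ A , B ] a ≃ map (to h) a
  ↪⇒≃ h a (equal s t) = mk⇔
    (λ eq → trans (sym (eval-↪ h a s)) (trans (cong (to h) eq) (eval-↪ h a t)))
    (λ eq → injective h (trans (eval-↪ h a s) (trans eq (sym (eval-↪ h a t)))))
  ↪⇒≃ {A} {B} h a (holds R ts) =
    subst (λ xs → rel A R (evals A a ts) ⇔ rel B R xs) (evals-↪ h a ts)
      (to-rel h R (evals A a ts))

  ≃-trans : ∀ {A B C : Structure L} {k} {a : Vec (Carrier A) k}
            {b : Vec (Carrier B) k} {c : Vec (Carrier C) k} →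
            [ A , B ] a ≃ b → [ B , C ] b ≃ c → [ A , C ] a ≃ c
  ≃-trans p q φ = ⇔-trans (p φ) (q φ)

-- Tuples of a computable structure and their codes.

module _ {L : Language} (A : ComputableStructure L) where
  open ComputableStructure A

  Elem-≡ : {x y : Elem} → proj₁ x ≡ proj₁ y → x ≡ y
  Elem-≡ refl = cong (_ ,_) (T-irrelevant _ _)

  -- Only the empty tuple has code 0, so the length is recovered by recursion along with the
  -- entries. The resulting equality supplies the `cast` in `IsEmbedding`.
  code-injective : ∀ {m n} (a : Vec Elem m) (b : Vec Elem n) →
                   code a ≡ code b → Σ[ eq ∈ m ≡ n ] cast eq a ≡ b
  code-injective []      []      _  = refl , refl
  code-injective (x ∷ a) (y ∷ b) eq
    with ⟨,⟩-injective (proj₁ x) (code a) (proj₁ y) (code b) (suc-injective eq)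
  ... | x≡y , eq′ with refl , a≡b ← code-injective a b eq′ =
    refl , cong₂ _∷_ (Elem-≡ x≡y) a≡b

-- Queries to the embedding information.

module _ {L : Language} {ℓ} {K : Age L ℓ} (𝕂 : ComputableAge K) where
  open ComputableAge 𝕂
  open ComputableStructure using (structure; code; index)
  open PotentialEmbedding

  embeddingQuery : ℕ → ℕ → ℕ → ℕ
  embeddingQuery u t c = ⟨ u , ⟨ π₁ u , ⟨ t , c ⟩ ⟩ ⟩

  𝕀-injective : ∀ {i j} → 𝕀 i ≡ 𝕀 j → i ≡ j
  𝕀-injective {i} {j} eq = proj₂ (⟨,⟩-injective (index (𝒜 i)) i (index (𝒜 j)) j
    (proj₂ (⟨,⟩-injective (code (𝒜 i) (gens i)) ⟨ index (𝒜 i) , i ⟩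
                          (code (𝒜 j) (gens j)) ⟨ index (𝒜 j) , j ⟩ eq)))

  π₁-𝕀 : ∀ i → π₁ (𝕀 i) ≡ code (𝒜 i) (gens i)
  π₁-𝕀 i = π₁-⟨,⟩ (code (𝒜 i) (gens i)) ⟨ index (𝒜 i) , i ⟩

  -- The arguments are tied to codes by equations, since they will be projections of paired numbers,
  -- which agree with the codes only propositionally.
  ≃⇒EI : ∀ {u t m i j} (c : Vec _ (len i)) →
         u ≡ 𝕀 i → t ≡ 𝕀 j → m ≡ code (𝒜 j) c →
         [ structure (𝒜 i) , structure (𝒜 j) ] gens i ≃ c →
         EI (embeddingQuery u t m)
  ≃⇒EI {i = i} {j} c refl refl refl p = i , j , len i , gens i , c ,
    cong (λ g → ⟨ 𝕀 i , ⟨ g , ⟨ 𝕀 j , code (𝒜 j) c ⟩ ⟩ ⟩) (π₁-𝕀 i) , p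

  EI⇒𝕀 : ∀ {u t c} → EI (embeddingQuery u t c) → ∃[ i ] u ≡ 𝕀 i
  EI⇒𝕀 {u} {t} {c} (i , j , _ , b₀ , b₁ , eq , _) =
    i , proj₁ (⟨,⟩-injective u ⟨ π₁ u , ⟨ t , c ⟩ ⟩
                (𝕀 i) ⟨ code (𝒜 i) b₀ , ⟨ 𝕀 j , code (𝒜 j) b₁ ⟩ ⟩ eq)

  -- The first tuple of the query has code `π₁ u`, the code of `gens i`. Injectivity of `𝕀` and of
  -- tuple codes thus forces `k₀` to be `i` and `b₀` to be the generators.
  EI⇒embedding : ∀ {u t m i} → u ≡ 𝕀 i → EI (embeddingQuery u t m) →
    Σ[ F ∈ PotentialEmbedding ] IsEmbedding F × domain F ≡ 𝕀 i × codomain F ≡ t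
      × embeddingCode F ≡ ⟨ u , ⟨ t , m ⟩ ⟩
  EI⇒embedding {u} {t} {m} {i} u≡ (k₀ , k₁ , n , b₀ , b₁ , eq , p) =
    build (𝕀-injective (trans (sym u≡) (proj₁ split₁))) (proj₁ split₃) (proj₂ split₃)
      b₀ (trans (sym (trans (cong π₁ u≡) (π₁-𝕀 i))) (proj₁ split₂)) p
    where
    split₁ = ⟨,⟩-injective u ⟨ π₁ u , ⟨ t , m ⟩ ⟩
      (𝕀 k₀) ⟨ code (𝒜 k₀) b₀ , ⟨ 𝕀 k₁ , code (𝒜 k₁) b₁ ⟩ ⟩ eq
    split₂ = ⟨,⟩-injective (π₁ u) ⟨ t , m ⟩
      (code (𝒜 k₀) b₀) ⟨ 𝕀 k₁ , code (𝒜 k₁) b₁ ⟩ (proj₂ split₁)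
    split₃ = ⟨,⟩-injective t m (𝕀 k₁) (code (𝒜 k₁) b₁) (proj₂ split₂)

    F : PotentialEmbedding
    F = record { source = i ; target = k₁ ; tuple = b₁ }

    isEmbedding : ∀ {b₀} → Σ[ e ∈ len i ≡ n ] cast e (gens i) ≡ b₀ →
                  [ structure (𝒜 i) , structure (𝒜 k₁) ] b₀ ≃ b₁ → IsEmbedding F
    isEmbedding (e , refl) p = e , p

    -- `k₀` and `b₀` are generalised so that matching on `i ≡ k₀` moves `b₀` into `𝒜 i`, where it
    -- can be compared with `gens i`.
    build : ∀ {k₀} → i ≡ k₀ → t ≡ 𝕀 k₁ → m ≡ code (𝒜 k₁) b₁ →
      (b₀ : Vec _ n) → code (𝒜 i) (gens i) ≡ code (𝒜 k₀) b₀ →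
      [ structure (𝒜 k₀) , structure (𝒜 k₁) ] b₀ ≃ b₁ →
      Σ[ F ∈ PotentialEmbedding ] IsEmbedding F × domain F ≡ 𝕀 i × codomain F ≡ t
        × embeddingCode F ≡ ⟨ u , ⟨ t , m ⟩ ⟩
    build refl t≡ m≡ b₀ g≡ p =
      F , isEmbedding (code-injective (𝒜 i) (gens i) b₀ g≡) p , refl , sym t≡ ,
      sym (cong₂ ⟨_,_⟩ u≡ (cong₂ ⟨_,_⟩ t≡ m≡))

  -- Joint witnesses.

  -- w codes ⟨ t , ⟨ c , d ⟩ ⟩ with t the common codomain.
  JointWitness : ℕ → ℕ → Set
  JointWitness x w = EI (embeddingQuery (π₁ x) (π₁ w) (π₁ (π₂ w)))
                   × EI (embeddingQuery (π₂ x) (π₁ w) (π₂ (π₂ w)))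

  -- Both entries have the shape of `embeddingCode`, so the output is assembled from `x` and `w` by
  -- projections and pairing alone.
  result : ℕ → ℕ → ℕ
  result x w = ⟨ ⟨ π₁ x , ⟨ π₁ w , π₁ (π₂ w) ⟩ ⟩
               , ⟨ π₂ x , ⟨ π₁ w , π₂ (π₂ w) ⟩ ⟩ ⟩

  -- `complete` replaces the structure given by `JEP` with an isomorphic `𝒜 k`, which has a name;
  -- `c` and `d` are the images of the generators there.
  jointWitness : JEP K → ∀ i j → ∃ (JointWitness ⟨ 𝕀 i , 𝕀 j ⟩)
  jointWitness jep i j =
    let C , C∈K , f , g = jep (member i) (member j) ; k , iso = complete C∈K in
    common f g (_≅_.embedding iso)
    where
    common : ∀ {C k} → structure (𝒜 i) ↪ C → structure (𝒜 j) ↪ C →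
             C ↪ structure (𝒜 k) → ∃ (JointWitness ⟨ 𝕀 i , 𝕀 j ⟩)
    common {k = k} f g h = w ,
      ≃⇒EI c (π₁-⟨,⟩ (𝕀 i) (𝕀 j)) (π₁-⟨,⟩ (𝕀 k) cd)
        (trans (cong π₁ π₂-w) (π₁-⟨,⟩ (code (𝒜 k) c) (code (𝒜 k) d)))
        (≃-trans (↪⇒≃ f (gens i)) (↪⇒≃ h (map (_↪_.to f) (gens i)))) ,
      ≃⇒EI d (π₂-⟨,⟩ (𝕀 i) (𝕀 j)) (π₁-⟨,⟩ (𝕀 k) cd)
        (trans (cong π₂ π₂-w) (π₂-⟨,⟩ (code (𝒜 k) c) (code (𝒜 k) d)))
        (≃-trans (↪⇒≃ g (gens j)) (↪⇒≃ h (map (_↪_.to g) (gens j))))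
      where
      c  = map (_↪_.to h) (map (_↪_.to f) (gens i))
      d  = map (_↪_.to h) (map (_↪_.to g) (gens j))
      cd = ⟨ code (𝒜 k) c , code (𝒜 k) d ⟩
      w  = ⟨ 𝕀 k , cd ⟩

      π₂-w : π₂ w ≡ cd
      π₂-w = π₂-⟨,⟩ (𝕀 k) cd

  -- Keeps the program from halting outside the pairs of members: each query forces one component of
  -- `x` to be a name, and pairing is onto.
  JointWitness⇒𝕀 : ∀ {x w} → JointWitness x w → ∃[ i ] ∃[ j ] x ≡ ⟨ 𝕀 i , 𝕀 j ⟩
  JointWitness⇒𝕀 {x} {w} (p , q) =
    let i , u≡𝕀i = EI⇒𝕀 {π₁ x} {π₁ w} {π₁ (π₂ w)} p
        j , v≡𝕀j = EI⇒𝕀 {π₂ x} {π₁ w} {π₂ (π₂ w)} q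
    in i , j , trans (sym (⟨π₁,π₂⟩ x)) (cong₂ ⟨_,_⟩ u≡𝕀i v≡𝕀j)

  -- The same `π₁ w` is the target name in both queries, whence the common codomain.
  JointWitness⇒embeddings : ∀ {x w i j} → π₁ x ≡ 𝕀 i → π₂ x ≡ 𝕀 j → JointWitness x w →
    Σ[ (F₀ , F₁) ∈ PotentialEmbedding × PotentialEmbedding ]
      (IsEmbedding F₀ × IsEmbedding F₁ × domain F₀ ≡ 𝕀 i × domain F₁ ≡ 𝕀 j
        × codomain F₀ ≡ codomain F₁)
      × result x w ≡ ⟨ embeddingCode F₀ , embeddingCode F₁ ⟩
  JointWitness⇒embeddings {x} {w} u≡ v≡ (p , q) =
    let F₀ , emb₀ , dom₀ , cod₀ , code₀ = EI⇒embedding {π₁ x} {π₁ w} {π₁ (π₂ w)} u≡ p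
        F₁ , emb₁ , dom₁ , cod₁ , code₁ = EI⇒embedding {π₂ x} {π₁ w} {π₂ (π₂ w)} v≡ q
    in (F₀ , F₁) , (emb₀ , emb₁ , dom₀ , dom₁ , trans cod₀ (sym cod₁)) ,
       sym (cong₂ ⟨_,_⟩ code₀ code₁)

  -- The search program.

  _computesEI_ : Code → (ℕ → ℕ) → Set
  _computesEI_ = _computes_ {EI}

  embeddingQueryCode : Code → Code → Code → Code
  embeddingQueryCode u t c = pair u (pair (comp left u) (pair t c))

  embeddingQuery-computes : ∀ {u t c U T C} →
    u computesEI U → t computesEI T → c computesEI C →
    embeddingQueryCode u t c computesEI (λ z → embeddingQuery (U z) (T z) (C z))
  embeddingQuery-computes u t c = pair-computes u
    (pair-computes (comp-computes left-computes u) (pair-computes t c))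

  open _computes_

  -- Components of an input ⟨ ⟨ u , v ⟩ , ⟨ t , ⟨ c , d ⟩ ⟩ ⟩.
  uCode vCode tCode cCode dCode : Code
  uCode = comp left left
  vCode = comp right left
  tCode = comp left right
  cCode = comp left (comp right right)
  dCode = comp right (comp right right)

  searchCode resultCode programCode : Code
  searchCode  = rfind (pair (query (embeddingQueryCode uCode tCode cCode))
                            (query (embeddingQueryCode vCode tCode dCode)))
  resultCode  = pair (pair uCode (pair tCode cCode)) (pair vCode (pair tCode dCode))
  -- `pair left right` is the identity because pairing is onto; it carries the input past the
  -- search, to be paired with the witness found.
  programCode = comp resultCode (pair (pair left right) searchCode)

  uCode-computes : uCode computesEI (π₁ ∘ π₁)
  uCode-computes = comp-computes left-computes left-computes

  vCode-computes : vCode computesEI (π₂ ∘ π₁)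
  vCode-computes = comp-computes right-computes left-computes

  tCode-computes : tCode computesEI (π₁ ∘ π₂)
  tCode-computes = comp-computes left-computes right-computes

  cCode-computes : cCode computesEI (π₁ ∘ π₂ ∘ π₂)
  cCode-computes = comp-computes left-computes (comp-computes right-computes right-computes)

  dCode-computes : dCode computesEI (π₂ ∘ π₂ ∘ π₂)
  dCode-computes = comp-computes right-computes (comp-computes right-computes right-computes)

  searchCode-computes : ExcludedMiddle 0ℓ →
    Computes EI searchCode (λ x → Least (JointWitness x))
  searchCode-computes em = rfind-tests (pair-tests
    (query-tests em (embeddingQuery-computes uCode-computes tCode-computes cCode-computes))
    (query-tests em (embeddingQuery-computes vCode-computes tCode-computes dCode-computes)))

  resultCode-computes : resultCode computesEI (λ z → result (π₁ z) (π₂ z))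
  resultCode-computes = pair-computes
    (pair-computes uCode-computes (pair-computes tCode-computes cCode-computes))
    (pair-computes vCode-computes (pair-computes tCode-computes dCode-computes))

  programCode-computes : ExcludedMiddle 0ℓ → Computes EI programCode
    (λ x y → ∃[ w ] Least (JointWitness x) w × y ≡ result x w)
  programCode-computes em x y = mk⇔
    (λ { (z , (x′ , w , rx , rw , refl) , ry) →
         w , to (searchCode-computes em x w) rw ,
         trans (value resultCode-computes z ry)
           (cong₂ result (trans (π₁-⟨,⟩ x′ w) (trans (value id-computes x rx) (⟨π₁,π₂⟩ x)))
                         (π₂-⟨,⟩ x′ w)) })
    (λ { (w , least-w , eq) →
         ⟨ x , w ⟩ ,
         (x , w , run-≡ id-computes x (sym (⟨π₁,π₂⟩ x)) ,
          from (searchCode-computes em x w) least-w , refl) ,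
         run-≡ resultCode-computes ⟨ x , w ⟩
           (trans eq (cong₂ result (sym (π₁-⟨,⟩ x w)) (sym (π₂-⟨,⟩ x w)))) })
    where
    id-computes : pair left right computesEI (λ n → ⟨ π₁ n , π₂ n ⟩)
    id-computes = pair-computes left-computes right-computes

  -- The joint embedding function.

  computableJEP : ExcludedMiddle 0ℓ → JEP K → ComputableJEP EI
  computableJEP em jep = f , (programCode , graph) , λ i j → proj₁ (proj₂ (embeddings i j))
    where
    -- The search returns the least witness, so `f` is read off that one, to have the same graph as
    -- the program.
    minimal : ∀ i j → ∃ (Least (JointWitness ⟨ 𝕀 i , 𝕀 j ⟩))
    minimal i j = least em (jointWitness jep i j)

    embeddings = λ i j →
      JointWitness⇒embeddings {⟨ 𝕀 i , 𝕀 j ⟩} {proj₁ (minimal i j)} {i} {j}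
        (π₁-⟨,⟩ (𝕀 i) (𝕀 j)) (π₂-⟨,⟩ (𝕀 i) (𝕀 j)) (proj₁ (proj₂ (minimal i j)))

    f : ℕ → ℕ → PotentialEmbedding × PotentialEmbedding
    f i j = proj₁ (embeddings i j)

    f-code : ℕ → ℕ → ℕ
    f-code i j = ⟨ embeddingCode (proj₁ (f i j)) , embeddingCode (proj₂ (f i j)) ⟩

    result-minimal : ∀ i j → result ⟨ 𝕀 i , 𝕀 j ⟩ (proj₁ (minimal i j)) ≡ f-code i j
    result-minimal i j = proj₂ (proj₂ (embeddings i j))

    sound : ∀ {x y} → ∃[ w ] Least (JointWitness x) w × y ≡ result x w →
            ∃[ i ] ∃[ j ] x ≡ ⟨ 𝕀 i , 𝕀 j ⟩ × y ≡ f-code i j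
    sound {x} {y} (w , least-w , eq) =
      let i , j , x≡ = JointWitness⇒𝕀 {x} {w} (proj₁ least-w) in i , j , x≡ , y≡ i j x≡
      where
      y≡ : ∀ i j → x ≡ ⟨ 𝕀 i , 𝕀 j ⟩ → y ≡ f-code i j
      -- The program's witness and the chosen one are both least for the same input, hence equal.
      y≡ i j refl = trans eq (trans
        (cong (result x) (Least-unique least-w (proj₂ (minimal i j))))
        (result-minimal i j))

    realised : ∀ {x y} → ∃[ i ] ∃[ j ] x ≡ ⟨ 𝕀 i , 𝕀 j ⟩ × y ≡ f-code i j →
                ∃[ w ] Least (JointWitness x) w × y ≡ result x w
    realised (i , j , refl , eq) =
      proj₁ (minimal i j) , proj₂ (minimal i j) , trans eq (sym (result-minimal i j))

    graph : Computes EI programCode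
      (λ x y → ∃[ i ] ∃[ j ] x ≡ ⟨ 𝕀 i , 𝕀 j ⟩ × y ≡ f-code i j)
    graph x y = ⇔-trans (programCode-computes em x y) (mk⇔ sound realised)

proposition5p20 : ExcludedMiddle 0ℓ →
    ∀ {ℓ} (L : Language) (K : Age L ℓ) (𝕂 : ComputableAge K) →
    JEP K → ComputableAge.ComputableJEP 𝕂 (ComputableAge.EI 𝕂)
proposition5p20 em L K 𝕂 = computableJEP 𝕂 em
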